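{- Every graph in $\varepsilon_{12}$ has a node of degree $2$.
   Context: All graphs are finite, simple and connected. An Euler graph is a connected graph all of whose nodes have even degree. A cycle of length $n$ is of type $i$ if $n\equiv i\pmod 4$. $\varepsilon_{12}$ is the class of Euler graphs in which every cycle has length $\equiv 1$ or $\equiv 2\pmod 4$ and which contain at least one cycle of each of the types $1$ and $2$. -}

module Defs where

open import Data.Nat using (ℕ; zero; suc; _+_; _%_; _≤_; _<_)
open import Data.Nat.DivMod using (_mod_)
open import Data.Bool using (Bool; true; false; if_then_else_)
open import Data.Fin using (Fin; toℕ; fromℕ<; zero; suc)
open import Data.List using (List; map; allFin)
open import Data.Nat.ListAction using (sum)
open import Data.Product using (Σ; _×_; _,_; ∃; ∃-syntax)
open import Data.Sum using (_⊎_)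
open import Relation.Binary.PropositionalEquality using (_≡_; _≢_)
open import Function.Definitions using (Injective)

record Graph (n : ℕ) : Set where
  field
    adj   : Fin n → Fin n → Bool
    sym   : ∀ i j → adj i j ≡ adj j i
    irrefl : ∀ i → adj i i ≡ false

open Graph public

Adj : ∀ {n} → Graph n → Fin n → Fin n → Set
Adj G i j = adj G i j ≡ true

degree : ∀ {n} → Graph n → Fin n → ℕ
degree {n} G i = sum (map (λ j → if adj G i j then 1 else 0) (allFin n))

record Walk {n} (G : Graph n) (u v : Fin n) : Set where
  field
    len   : ℕ
    vert  : Fin (suc len) → Fin n
    start : vert zero ≡ u
    end   : vert (Data.Fin.fromℕ len) ≡ v
    step  : ∀ (i : Fin len) → Adj G (vert (Data.Fin.inject₁ i)) (vert (suc i))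

Connected : ∀ {n} → Graph n → Set
Connected {n} G = ∀ (u v : Fin n) → Walk G u v

Even : ℕ → Set
Even m = m % 2 ≡ 0

-- Euler graph: connected, every vertex of even degree
-- (the paper's standing convention that graphs are connected is built in)
Euler : ∀ {n} → Graph n → Set
Euler {n} G = Connected G × (∀ (i : Fin n) → Even (degree G i))

nextMod : ∀ {k} → Fin k → Fin k
nextMod {suc k} i = (suc (toℕ i)) mod (suc k)

record Cycle {n} (G : Graph n) (k : ℕ) : Set where
  field
    three : 3 ≤ k
    vert  : Fin k → Fin n
    inj   : Injective _≡_ _≡_ vert
    step  : ∀ (i : Fin k) → Adj G (vert i) (vert (nextMod i))

OfType : ℕ → ℕ → Set
OfType t k = k % 4 ≡ t

InE12 : ∀ {n} → Graph n → Set
InE12 G =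
  Euler G
  × (∀ k → Cycle G k → OfType 1 k ⊎ OfType 2 k)
  × (∃[ k ] (Cycle G k × OfType 1 k))
  × (∃[ k ] (Cycle G k × OfType 2 k))

{-# OPTIONS --safe #-}

-- In a graph of minimum degree at least 3, take a path x … y h … e such that x
-- and y are both adjacent to h, with the whole path as long as possible and then
-- the cycle x … y h as short as possible.  Rotating the path along that cycle
-- exchanges x and y, so by extremality x and y each have a further neighbour in
-- the tail after h.  The resulting crossing chords form a subdivided K₄ (or a
-- 4-cycle), and no subdivided K₄ has all its cycle lengths ≡ 1 or 2 (mod 4).

module Submission where

open import Defs hiding (sym)
open import Data.Bool using (true; false; if_then_else_)
open import Data.Bool.Properties using () renaming (_≟_ to _≟ᵇ_)
open import Data.Empty using (⊥; ⊥-elim)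
open import Data.Fin using (Fin; zero; suc; toℕ)
open import Data.Fin.Properties using (_≟_; 0≢1+n; any?; toℕ<n; toℕ-fromℕ<; injective⇒≤)
open import Data.List using (List; []; _∷_; _++_; length; lookup; filter; reverse; map; allFin)
open import Data.List.Membership.Propositional using (_∈_)
open import Data.List.Membership.Propositional.Properties using (∈-++⁻; ∈-filter⁺; ∈-filter⁻; ∈-allFin; ∈-lookup; ∈-length)
open import Data.List.Properties using (length-++; length-reverse; unfold-reverse; ++-assoc)
open import Data.List.Relation.Binary.Permutation.Propositional using (_↭_; ↭-refl; ↭-sym; prep; swap; ↭⇒↭ₛ)
open import Data.List.Relation.Binary.Permutation.Propositional.Properties using (↭-reverse; ↭-length) renaming (++⁺ˡ to ↭-++⁺ˡ; ++⁺ʳ to ↭-++⁺ʳ)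
open import Data.List.Relation.Binary.Permutation.Setoid.Properties using (Unique-resp-↭)
open import Data.List.Relation.Binary.Sublist.Propositional using (_⊆_; []; _∷_; _∷ʳ_; ⊆-refl; from∈)
open import Data.List.Relation.Binary.Sublist.Propositional.Properties using (All-resp-⊆; ++⁺; ++⁺ʳ)
open import Data.List.Relation.Unary.All as All using ()
open import Data.List.Relation.Unary.All.Properties using (¬Any⇒All¬)
open import Data.List.Relation.Unary.AllPairs using ([]; _∷_)
open import Data.List.Relation.Unary.Any as Any using (here; there)
open import Data.List.Relation.Unary.Unique.Propositional using (Unique)
open import Data.List.Relation.Unary.Unique.Propositional.Properties using (allFin⁺; filter⁺)
open import Data.Nat using (ℕ; zero; suc; _+_; _≤_; _<_; _%_; z≤n; s≤s; s<s)
open import Data.Nat.DivMod using (m%n<n; m<n⇒m%n≡m; n%n≡0)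
open import Data.Nat.Induction using (<-rec)
open import Data.Nat.ListAction using (sum)
open import Data.Nat.Properties using (≤-refl; ≤-trans; ≤-reflexive; <⇒≤; <⇒≱; m≤n⇒m<n∨m≡n; suc-injective; +-suc; +-comm; +-mono-≤; +-monoʳ-≤; m≤m+n) renaming (_≟_ to _≟ⁿ_)
open import Data.Product using (_×_; _,_; ∃-syntax; proj₂)
open import Data.Sum using (_⊎_; inj₁; inj₂)
open import Function using (_∘_)
open import Relation.Binary.PropositionalEquality using (_≡_; _≢_; refl; sym; trans; cong; subst; setoid)
open import Relation.Nullary using (¬_; Dec; yes; no)

-- Duplicate-free lists

module _ {a} {A : Set a} where

  Unique-⊆ : {xs ys : List A} → xs ⊆ ys → Unique ys → Unique xs
  Unique-⊆ []         []       = []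
  Unique-⊆ (_ ∷ʳ s)   (_ ∷ u)  = Unique-⊆ s u
  Unique-⊆ (refl ∷ s) (px ∷ u) = All-resp-⊆ s px ∷ Unique-⊆ s u

  Unique-↭ : {xs ys : List A} → xs ↭ ys → Unique xs → Unique ys
  Unique-↭ p = Unique-resp-↭ (setoid A) (↭⇒↭ₛ p)

  lookup-injective : {xs : List A} → Unique xs → ∀ {i j} → lookup xs i ≡ lookup xs j → i ≡ j
  lookup-injective (_ ∷ _)  {zero}  {zero}  eq = refl
  lookup-injective (px ∷ _) {zero}  {suc j} eq = ⊥-elim (All.lookup px (∈-lookup j) eq)
  lookup-injective (px ∷ _) {suc i} {zero}  eq = ⊥-elim (All.lookup px (∈-lookup i) (sym eq))
  lookup-injective (_ ∷ u)  {suc i} {suc j} eq = cong suc (lookup-injective u eq)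

Unique⇒length≤ : ∀ {n} {xs : List (Fin n)} → Unique xs → length xs ≤ n
Unique⇒length≤ u = injective⇒≤ (lookup-injective u)

-- Cycle lengths modulo 4

Type12 : ℕ → Set
Type12 k = OfType 1 k ⊎ OfType 2 k

¬Type12-0 : ¬ Type12 0
¬Type12-0 (inj₁ ())
¬Type12-0 (inj₂ ())

¬Type12-3 : ¬ Type12 3
¬Type12-3 (inj₁ ())
¬Type12-3 (inj₂ ())

-- a, p and q are the numbers of vertices on the three segments A, P and Q of a
-- subdivided K₄.
K₄-lengths : ∀ a p q →
  Type12 (1 + a) → Type12 (1 + p) → Type12 (1 + (p + q)) →
  Type12 (a + p) → Type12 (1 + (a + q)) → Type12 (4 + q) → ⊥
-- `_%_` sheds four successors by computation, so only residues matter. Since `_+_` recurses on its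
-- left argument, `p` can be reduced only once `a` is a numeral, and `q` only after both. The first
-- two lengths then leave residues 0 and 1 for `a` and `p`.
K₄-lengths (suc (suc (suc (suc a)))) p q = K₄-lengths a p q
K₄-lengths 2 _ _ t _ _ _ _ _ = ¬Type12-3 t
K₄-lengths 3 _ _ t _ _ _ _ _ = ¬Type12-0 t
K₄-lengths 0 (suc (suc (suc (suc p)))) q = K₄-lengths 0 p q
K₄-lengths 0 0 _ _ _ _ t _ _ = ¬Type12-0 t
K₄-lengths 0 2 _ _ t _ _ _ _ = ¬Type12-3 t
K₄-lengths 0 3 _ _ t _ _ _ _ = ¬Type12-0 t
K₄-lengths 0 1 (suc (suc (suc (suc q)))) = K₄-lengths 0 1 q
K₄-lengths 0 1 0 _ _ _ _ _ t = ¬Type12-0 t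
K₄-lengths 0 1 1 _ _ t _ _ _ = ¬Type12-3 t
K₄-lengths 0 1 2 _ _ t _ _ _ = ¬Type12-0 t
K₄-lengths 0 1 3 _ _ _ _ _ t = ¬Type12-3 t
K₄-lengths 1 (suc (suc (suc (suc p)))) q = K₄-lengths 1 p q
K₄-lengths 1 2 _ _ t _ _ _ _ = ¬Type12-3 t
K₄-lengths 1 3 _ _ t _ _ _ _ = ¬Type12-0 t
K₄-lengths 1 0 (suc (suc (suc (suc q)))) = K₄-lengths 1 0 q
K₄-lengths 1 0 0 _ _ _ _ _ t = ¬Type12-0 t
K₄-lengths 1 0 1 _ _ _ _ t _ = ¬Type12-3 t
K₄-lengths 1 0 2 _ _ t _ _ _ = ¬Type12-3 t
K₄-lengths 1 0 3 _ _ _ _ _ t = ¬Type12-3 t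
K₄-lengths 1 1 (suc (suc (suc (suc q)))) = K₄-lengths 1 1 q
K₄-lengths 1 1 0 _ _ _ _ _ t = ¬Type12-0 t
K₄-lengths 1 1 1 _ _ t _ _ _ = ¬Type12-3 t
K₄-lengths 1 1 2 _ _ t _ _ _ = ¬Type12-0 t
K₄-lengths 1 1 3 _ _ _ _ _ t = ¬Type12-3 t

-- Degrees

pick-third : ∀ {n} {c₁ c₂ c₃ : Fin n} {cs} → Unique (c₁ ∷ c₂ ∷ c₃ ∷ cs) →
             ∀ a b → ∃[ w ] (w ∈ c₁ ∷ c₂ ∷ c₃ ∷ cs × w ≢ a × w ≢ b)
pick-third {c₁ = c₁} {c₂} {c₃} ((c₁≢c₂ All.∷ c₁≢c₃ All.∷ _) ∷ (c₂≢c₃ All.∷ _) ∷ _) a b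
  with c₁ ≟ a | c₁ ≟ b | c₂ ≟ a | c₂ ≟ b
... | no ≢a    | no ≢b    | _        | _        = c₁ , here refl , ≢a , ≢b
... | _        | _        | no ≢a    | no ≢b    = c₂ , there (here refl) , ≢a , ≢b
... | yes refl | _        | yes refl | _        = ⊥-elim (c₁≢c₂ refl)
... | yes refl | _        | no _     | yes refl = c₃ , there (there (here refl)) , c₁≢c₃ ∘ sym , c₂≢c₃ ∘ sym
... | no _     | yes refl | yes refl | _        = c₃ , there (there (here refl)) , c₂≢c₃ ∘ sym , c₁≢c₃ ∘ sym
... | no _     | yes refl | no _     | yes refl = ⊥-elim (c₁≢c₂ refl)

module _ {n} (G : Graph n) where

  Adj-sym : ∀ {u v} → Adj G u v → Adj G v u
  Adj-sym {u} {v} e = trans (Graph.sym G v u) e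

  Adj⇒≢ : ∀ {u v} → Adj G u v → u ≢ v
  Adj⇒≢ {u} e refl with trans (sym e) (Graph.irrefl G u)
  ... | ()

  adj? : ∀ u v → Dec (Adj G u v)
  adj? u v = adj G u v ≟ᵇ true

  neighbours : Fin n → List (Fin n)
  neighbours u = filter (adj? u) (allFin n)

  sum-indicator : ∀ u xs → sum (map (λ j → if adj G u j then 1 else 0) xs) ≡ length (filter (adj? u) xs)
  sum-indicator u []       = refl
  sum-indicator u (x ∷ xs) with adj G u x
  ... | true  = cong suc (sum-indicator u xs)
  ... | false = sum-indicator u xs

  degree≡length-neighbours : ∀ u → degree G u ≡ length (neighbours u)
  degree≡length-neighbours u = sum-indicator u (allFin n)

  third-neighbour : ∀ {u} → 3 ≤ degree G u → ∀ a b → ∃[ w ] (Adj G u w × w ≢ a × w ≢ b)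
  third-neighbour {u} 3≤d a b = go (neighbours u) (λ w∈ → proj₂ (∈-filter⁻ (adj? u) {xs = allFin n} w∈))
    (filter⁺ (adj? u) (allFin⁺ n)) (subst (3 ≤_) (degree≡length-neighbours u) 3≤d)
    where
    go : ∀ cs → (∀ {w} → w ∈ cs → Adj G u w) → Unique cs → 3 ≤ length cs →
         ∃[ w ] (Adj G u w × w ≢ a × w ≢ b)
    go (c₁ ∷ c₂ ∷ c₃ ∷ cs) adjacent uniq _ =
      let w , w∈ , ≢a , ≢b = pick-third uniq a b in w , adjacent w∈ , ≢a , ≢b
    go (_ ∷ [])     _ _ (s≤s ())
    go (_ ∷ _ ∷ []) _ _ (s≤s (s≤s ()))

  neighbour⇒degree>0 : ∀ {u v} → Adj G u v → 1 ≤ degree G u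
  neighbour⇒degree>0 {u} {v} e = subst (1 ≤_) (sym (degree≡length-neighbours u))
    (∈-length (∈-filter⁺ (adj? u) (∈-allFin v) e))

  first-step : ∀ {u v} → Walk G u v → u ≢ v → ∃[ w ] Adj G u w
  first-step w u≢v with Walk.len w | Walk.vert w | Walk.start w | Walk.end w | Walk.step w
  ... | zero  | vert | refl | refl | step = ⊥-elim (u≢v refl)
  ... | suc _ | vert | refl | _    | step = vert (suc zero) , step zero

  -- The cycle has two distinct vertices, so one of them differs from `u`, and the walk to it leaves
  -- `u` along an edge.
  degree-positive : ∀ {k} → Connected G → Cycle G k → ∀ u → 1 ≤ degree G u
  degree-positive connected record { three = s≤s (s≤s _) ; vert = vert ; inj = inj } u
    with u ≟ vert zero
  ... | no  u≢ = neighbour⇒degree>0 (proj₂ (first-step (connected u (vert zero)) u≢))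
  ... | yes u≡ = neighbour⇒degree>0 (proj₂ (first-step (connected u (vert (suc zero)))
                   λ u≡′ → 0≢1+n (inj (trans (sym u≡) u≡′))))

  -- Paths

  infixr 5 _∷_

  data Path : Fin n → List (Fin n) → Fin n → Set where
    [_] : ∀ u → Path u (u ∷ []) u
    _∷_ : ∀ {u w v xs} → Adj G u w → Path w xs v → Path u (u ∷ xs) v

  start-∈ : ∀ {u xs v} → Path u xs v → u ∈ xs
  start-∈ [ _ ]   = here refl
  start-∈ (_ ∷ _) = here refl

  end-∈ : ∀ {u xs v} → Path u xs v → v ∈ xs
  end-∈ [ _ ]   = here refl
  end-∈ (_ ∷ p) = there (end-∈ p)

  length-pos : ∀ {u xs v} → Path u xs v → 1 ≤ length xs
  length-pos [ _ ]   = s≤s z≤n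
  length-pos (_ ∷ _) = s≤s z≤n

  ≢⇒2≤length : ∀ {u xs v} → Path u xs v → u ≢ v → 2 ≤ length xs
  ≢⇒2≤length [ _ ]   u≢v = ⊥-elim (u≢v refl)
  ≢⇒2≤length (_ ∷ p) _   = s≤s (length-pos p)

  ends-⊆ : ∀ {u xs v} → Path u xs v → 2 ≤ length xs → u ∷ v ∷ [] ⊆ xs
  ends-⊆ [ _ ]   (s≤s ())
  ends-⊆ (_ ∷ p) _ = refl ∷ from∈ (end-∈ p)

  join : ∀ {u xs v w ys z} → Path u xs v → Adj G v w → Path w ys z → Path u (xs ++ ys) z
  join [ _ ]   e q = e ∷ q
  join (d ∷ p) e q = d ∷ join p e q

  reverse-path : ∀ {u xs v} → Path u xs v → Path v (reverse xs) u
  reverse-path [ u ] = [ u ]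
  reverse-path (_∷_ {u} {xs = xs} e p) = subst (λ ys → Path _ ys u) (sym (unfold-reverse u xs))
    (join (reverse-path p) (Adj-sym e) [ u ])

  -- The predecessor `y` of `w` is what is wanted: if `u` is also adjacent to `w`, the first part
  -- closes up through `w` to a cycle.
  split-before : ∀ {u xs v w} → Path u xs v → w ∈ xs → w ≢ u →
    ∃[ ys ] ∃[ zs ] ∃[ y ] (Path u ys y × Adj G y w × Path w zs v × xs ≡ ys ++ zs)
  split-before [ _ ]   (here refl) w≢u = ⊥-elim (w≢u refl)
  split-before (_ ∷ _) (here refl) w≢u = ⊥-elim (w≢u refl)
  split-before {u} {w = w} (_∷_ {w = t} e p) (there w∈) _ with w ≟ t
  ... | yes refl = u ∷ [] , _ , u , [ u ] , e , p , refl
  ... | no  w≢t  with split-before p w∈ w≢t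
  ...   | ys , zs , y , p₁ , d , p₂ , refl = u ∷ ys , zs , y , e ∷ p₁ , d , p₂ , refl

  prefix : ∀ {u xs v w} → Path u xs v → w ∈ xs → ∃[ ys ] ∃[ zs ] (Path u ys w × xs ≡ ys ++ zs)
  prefix [ u ]           (here refl) = u ∷ [] , [] , [ u ] , refl
  prefix (_∷_ {u} _ _)   (here refl) = u ∷ [] , _ , [ u ] , refl
  prefix (_∷_ {u} e p)   (there w∈)  with prefix p w∈
  ... | ys , zs , q , refl = u ∷ ys , zs , e ∷ q , refl

  -- The path meets `s` before `t`. It is cut after each of them, so that `ys` and `zs` can serve as
  -- the segments P and Q of a subdivided K₄.
  Passes : Fin n → List (Fin n) → Fin n → Fin n → Set
  Passes u xs s t = ∃[ ys ] ∃[ zs ] ∃[ rest ] ∃[ r ]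
    (Path u ys s × Adj G s r × Path r zs t × xs ≡ ys ++ zs ++ rest)

  Passes-∷ : ∀ {u w xs s t} → Adj G u w → Passes w xs s t → Passes u (u ∷ xs) s t
  Passes-∷ e (ys , zs , rest , r , p , d , q , refl) = _ , zs , rest , r , e ∷ p , d , q , refl

  Passes-start : ∀ {u w xs v t} → Adj G u w → Path w xs v → t ∈ xs → Passes u (u ∷ xs) u t
  Passes-start {u} e p t∈ with prefix p t∈
  ... | zs , rest , q , refl = u ∷ [] , zs , rest , _ , [ u ] , e , q , refl

  passes : ∀ {u xs v s t} → Path u xs v → s ∈ xs → t ∈ xs → s ≢ t → Passes u xs s t ⊎ Passes u xs t s
  passes [ _ ]   (here refl) (here refl) s≢t = ⊥-elim (s≢t refl)
  passes (_ ∷ _) (here refl) (here refl) s≢t = ⊥-elim (s≢t refl)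
  passes (e ∷ p) (here refl) (there t∈)  _   = inj₁ (Passes-start e p t∈)
  passes (e ∷ p) (there s∈)  (here refl) _   = inj₂ (Passes-start e p s∈)
  passes (e ∷ p) (there s∈)  (there t∈)  s≢t with passes p s∈ t∈ s≢t
  ... | inj₁ st = inj₁ (Passes-∷ e st)
  ... | inj₂ ts = inj₂ (Passes-∷ e ts)

  -- Closed paths are cycles

  -- Positions are described by `toℕ` because `length xs` is not visibly a successor;
  -- `nextMod-cases` delivers them in this form.
  lookup-start : ∀ {u xs v} → Path u xs v → ∀ i → toℕ i ≡ 0 → lookup xs i ≡ u
  lookup-start [ _ ]   zero _ = refl
  lookup-start (_ ∷ _) zero _ = refl

  lookup-end : ∀ {u xs v} → Path u xs v → ∀ i → suc (toℕ i) ≡ length xs → lookup xs i ≡ v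
  lookup-end [ _ ]   zero    _  = refl
  lookup-end (_ ∷ [ _ ])   zero ()
  lookup-end (_ ∷ (_ ∷ _)) zero ()
  lookup-end (_ ∷ p) (suc i) eq = lookup-end p i (suc-injective eq)

  lookup-step : ∀ {u xs v} → Path u xs v → ∀ i j → toℕ j ≡ suc (toℕ i) → Adj G (lookup xs i) (lookup xs j)
  lookup-step (e ∷ p) zero    (suc j) eq = subst (Adj G _) (sym (lookup-start p j (suc-injective eq))) e
  lookup-step (_ ∷ p) (suc i) (suc j) eq = lookup-step p i j (suc-injective eq)
  lookup-step [ _ ]   zero    zero    ()

  toℕ-nextMod : ∀ {k} (i : Fin (suc k)) → toℕ (nextMod i) ≡ suc (toℕ i) % suc k
  toℕ-nextMod {k} i = toℕ-fromℕ< (m%n<n (suc (toℕ i)) (suc k))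

  nextMod-cases : ∀ {k} (i : Fin k) →
    toℕ (nextMod i) ≡ suc (toℕ i) ⊎ (suc (toℕ i) ≡ k × toℕ (nextMod i) ≡ 0)
  nextMod-cases {suc k} i with m≤n⇒m<n∨m≡n (toℕ<n i)
  ... | inj₁ i+1<k = inj₁ (trans (toℕ-nextMod i) (m<n⇒m%n≡m i+1<k))
  ... | inj₂ i+1≡k = inj₂ (i+1≡k , trans (toℕ-nextMod i) (trans (cong (_% suc k) i+1≡k) (n%n≡0 (suc k))))

  closed-path⇒cycle : ∀ {u xs v} → Path u xs v → Adj G v u → Unique xs → 3 ≤ length xs → Cycle G (length xs)
  closed-path⇒cycle {xs = xs} p e uniq 3≤ = record
    { three = 3≤
    ; vert  = lookup xs
    ; inj   = lookup-injective uniq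
    ; step  = step′
    }
    where
    step′ : ∀ i → Adj G (lookup xs i) (lookup xs (nextMod i))
    step′ i with nextMod-cases i
    ... | inj₁ eq         = lookup-step p i (nextMod i) eq
    ... | inj₂ (last , z) rewrite lookup-end p i last | lookup-start p (nextMod i) z = e

  -- The extremal path

  module _ (type12 : ∀ k → Cycle G k → Type12 k) where

    cycle-type : ∀ {u xs v} → Path u xs v → Adj G v u → Unique xs → 3 ≤ length xs → Type12 (length xs)
    cycle-type p e uniq 3≤ = type12 _ (closed-path⇒cycle p e uniq 3≤)

    -- Opposite vertices are listed together: in the application `a`, `c` lie on the segment A and
    -- `b`, `d` on the tail B.
    no-4-cycle : ∀ {a b c d} → Adj G a b → Adj G b c → Adj G c d → Adj G d a →
                 Unique (a ∷ c ∷ b ∷ d ∷ []) → ⊥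
    no-4-cycle ab bc cd da uniq = ¬Type12-0
      (cycle-type (ab ∷ bc ∷ cd ∷ [ _ ]) da (Unique-↭ (prep _ (swap _ _ ↭-refl)) uniq) (s≤s (s≤s (s≤s z≤n))))

    -- The branch vertices are `x`, `y`, `h`, `l`; A joins `x` to `y`, P joins `h` to `l`, Q runs
    -- inside the connection from `l` to `x`, and the other three connections are edges. The cycles
    -- are, in order: x...y h; y h...l; x h...l q...j; x...y l...h; x...y l q...j; x h y l q...j.
    no-K₄ : ∀ {x A y h P l q Q j} →
      Path x A y → 2 ≤ length A → Path h P l → 2 ≤ length P → Path q Q j → Unique (A ++ P ++ Q) →
      Adj G y h → Adj G x h → Adj G y l → Adj G l q → Adj G j x → ⊥
    no-K₄ {x} {A} {y} {h} {P} {l} {q} {Q} pA 2≤A pP 2≤P pQ uniq yh xh yl lq jx =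
      K₄-lengths (length A) (length P) (length Q)
        (subst Type12 (trans (length-++ A) (+-comm (length A) 1))
          (cycle-type (join pA yh [ h ]) (Adj-sym xh)
            (sub (++⁺ ⊆-refl (++⁺ʳ Q (from∈ (start-∈ pP)))))
            (≤-length-++ A 2≤A (s≤s z≤n))))
        (cycle-type (yh ∷ pP) (Adj-sym yl)
          (sub (++⁺ (from∈ (end-∈ pA)) (++⁺ʳ Q ⊆-refl))) (s≤s 2≤P))
        (subst Type12 (cong suc (length-++ P))
          (cycle-type (xh ∷ join pP lq pQ) jx
            (sub (++⁺ (from∈ (start-∈ pA)) ⊆-refl))
            (s≤s (≤-length-++ P (≤-trans (s≤s z≤n) 2≤P) (length-pos pQ)))))
        (subst Type12 (trans (length-++ A) (cong (length A +_) (length-reverse P)))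
          (cycle-type (join pA yl (reverse-path pP)) (Adj-sym xh)
            (Unique-↭ (↭-++⁺ˡ A (↭-sym (↭-reverse P))) (sub (++⁺ (⊆-refl {x = A}) (++⁺ʳ Q ⊆-refl))))
            (≤-length-++ A 2≤A (length-pos (reverse-path pP)))))
        (subst Type12 (trans (length-++ A) (+-suc (length A) (length Q)))
          (cycle-type (join pA yl (lq ∷ pQ)) jx
            (sub (++⁺ ⊆-refl (++⁺ (from∈ (end-∈ pP)) ⊆-refl)))
            (≤-length-++ A 2≤A (s≤s z≤n))))
        (cycle-type (xh ∷ Adj-sym yh ∷ yl ∷ lq ∷ pQ) jx
          (Unique-↭ (prep x (swap y h ↭-refl)) (sub (++⁺ (ends-⊆ pA 2≤A) (++⁺ (ends-⊆ pP 2≤P) ⊆-refl))))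
          (s≤s (s≤s (s≤s z≤n))))
      where
      sub : ∀ {xs} → xs ⊆ A ++ P ++ Q → Unique xs
      sub s = Unique-⊆ s uniq

      ≤-length-++ : ∀ {a b} xs {ys : List (Fin n)} → a ≤ length xs → b ≤ length ys → a + b ≤ length (xs ++ ys)
      ≤-length-++ xs a≤ b≤ = subst (_ ≤_) (sym (length-++ xs)) (+-mono-≤ a≤ b≤)

    -- The chord from `y` lands on the tail before the chord from `x`, so the tail supplies P from
    -- `h` to `l` and Q from there to `j`; `l ≢ h` keeps the branch vertices distinct.
    no-crossing-chords : ∀ {x A y h B e l j} →
      Path x A y → 2 ≤ length A → Path h B e → Unique (A ++ B) → Adj G y h → Adj G x h →
      l ≢ h → Adj G y l → Adj G x j → Passes h B l j → ⊥
    no-crossing-chords {A = A} pA 2≤A pB uniq yh xh l≢h yl xj (P , Q , rest , _ , pP , lq , pQ , refl) =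
      no-K₄ pA 2≤A pP (≢⇒2≤length pP (l≢h ∘ sym)) pQ
        (Unique-⊆ (++⁺ (⊆-refl {x = A}) (++⁺ (⊆-refl {x = P}) (++⁺ʳ rest ⊆-refl))) uniq)
        yh xh yl lq (Adj-sym xj)

    -- Longest paths and shortest lassos in minimum degree at least 3

    module _ (3≤degree : ∀ u → 3 ≤ degree G u) where

      NoPathLongerThan : ℕ → Set
      NoPathLongerThan m = ∀ {u xs v} → Path u xs v → Unique xs → m < length xs → ⊥

      -- m counts the vertices of the path x … y h … e, k those of its segment x … y.
      NoLasso : ℕ → ℕ → Set
      NoLasso m k = ∀ {x A y h B e} → Path x A y → 2 ≤ length A → Path h B e →
        Adj G y h → Adj G x h → Unique (A ++ B) → m ≡ length (A ++ B) → k ≡ length A → ⊥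

      -- Otherwise prepending `w` would give a longer path.
      extend : ∀ {m u xs v w} → NoPathLongerThan m → Path u xs v → Unique xs → m ≡ length xs →
               Adj G u w → w ∈ xs
      extend {xs = xs} {w = w} longest p uniq refl uw with Any.any? (w ≟_) xs
      ... | yes w∈ = w∈
      ... | no  w∉ = ⊥-elim (longest (Adj-sym uw ∷ p) (¬Any⇒All¬ xs w∉ ∷ uniq) ≤-refl)

      -- Take a neighbour of `x` other than its successor and `h`. By maximality it lies on the
      -- path, and on A it would close a shorter cycle.
      chord-to-tail : ∀ {m k} → NoPathLongerThan m → (∀ {k′} → k′ < k → NoLasso m k′) →
        ∀ {x A y h B e} → Path x A y → 2 ≤ length A → Path h B e → Adj G y h → Adj G x h →
        Unique (A ++ B) → m ≡ length (A ++ B) → k ≡ length A →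
        ∃[ w ] (Adj G x w × w ∈ B × w ≢ h)
      chord-to-tail longest shortest [ _ ] (s≤s ())
      chord-to-tail longest shortest {x} {_ ∷ A} {h = h} {B} pA@(_∷_ {w = x₂} xx₂ pA′) 2≤A pB yh xh uniq m≡ refl
        with third-neighbour (3≤degree x) x₂ h
      ... | w , xw , w≢x₂ , w≢h
        with ∈-++⁻ (x ∷ A) (extend longest (join pA yh pB) uniq m≡ xw)
      ...   | inj₂ w∈B          = w , xw , w∈B , w≢h
      ...   | inj₁ (here refl)  = ⊥-elim (Adj⇒≢ xw refl)
      ...   | inj₁ (there w∈A) with split-before pA′ w∈A w≢x₂
      ...     | A₁ , A₂ , _ , p₁ , d , p₂ , refl = ⊥-elim
        -- The same path, recut before `w`: `w` takes the place of `h`, and the rest of A moves into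
        -- the tail.
        (shortest (s<s (shorter A₁ p₂)) (xx₂ ∷ p₁) (s≤s (length-pos p₁)) (join p₂ yh pB) d xw
          (subst Unique assoc uniq) (trans m≡ (cong length assoc)) refl)
        where
        assoc : x ∷ (A₁ ++ A₂) ++ B ≡ x ∷ A₁ ++ A₂ ++ B
        assoc = cong (x ∷_) (++-assoc A₁ A₂ B)

        shorter : ∀ xs {u ys v} → Path u ys v → length xs < length (xs ++ ys)
        shorter []       p = length-pos p
        shorter (_ ∷ xs) p = s<s (shorter xs p)

      -- Well-founded induction on `k` stands in for choosing the shortest cycle. Reversing A keeps
      -- the vertices and both lengths, so `chord-to-tail` applies to `y` as well as to `x`.
      no-lasso : ∀ {m} → NoPathLongerThan m → ∀ k → NoLasso m k
      no-lasso {m} longest = <-rec (NoLasso m) step′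
        where
        step′ : ∀ k → (∀ {k′} → k′ < k → NoLasso m k′) → NoLasso m k
        step′ k shortest {x} {A} {y} {h} {B} pA 2≤A pB yh xh uniq m≡ k≡ = contradict
          (chord-to-tail longest shortest pA 2≤A pB yh xh uniq m≡ k≡)
          (chord-to-tail longest shortest pAʳ 2≤Aʳ pB xh yh uniqʳ
            (trans m≡ (↭-length A++B↭)) (trans k≡ (sym (length-reverse A))))
          where
          pAʳ : Path y (reverse A) x
          pAʳ = reverse-path pA

          2≤Aʳ : 2 ≤ length (reverse A)
          2≤Aʳ = subst (2 ≤_) (sym (length-reverse A)) 2≤A

          A++B↭ : A ++ B ↭ reverse A ++ B
          A++B↭ = ↭-++⁺ʳ B (↭-sym (↭-reverse A))

          uniqʳ : Unique (reverse A ++ B)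
          uniqʳ = Unique-↭ A++B↭ uniq

          contradict : ∃[ w ] (Adj G x w × w ∈ B × w ≢ h) → ∃[ l ] (Adj G y l × l ∈ B × l ≢ h) → ⊥
          contradict (w , xw , w∈B , w≢h) (l , yl , l∈B , l≢h) with l ≟ w
          -- Both chords end at the same vertex, giving the 4-cycle x h y w.
          ... | yes refl = no-4-cycle xh (Adj-sym yh) yl (Adj-sym xw)
                  (Unique-⊆ (++⁺ (ends-⊆ pA 2≤A) (h∷w⊆ pB w∈B w≢h)) uniq)
            where
            h∷w⊆ : ∀ {h B e w} → Path h B e → w ∈ B → w ≢ h → h ∷ w ∷ [] ⊆ B
            h∷w⊆ [ _ ]   (here refl) w≢h = ⊥-elim (w≢h refl)
            h∷w⊆ (_ ∷ _) (here refl) w≢h = ⊥-elim (w≢h refl)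
            h∷w⊆ (_ ∷ _) (there w∈)  _   = refl ∷ from∈ w∈
          ... | no l≢w with passes pB l∈B w∈B l≢w
          ...   | inj₁ lw = no-crossing-chords pA 2≤A pB uniq yh xh l≢h yl xw lw
          -- Here the chord from `x` lands first, so the reversed segment exchanges the roles of `x`
          -- and `y`.
          ...   | inj₂ wl = no-crossing-chords pAʳ 2≤Aʳ pB uniqʳ xh yh w≢h xw yl wl

      longest⇒⊥ : ∀ {u xs v} → Path u xs v → 2 ≤ length xs → Unique xs → NoPathLongerThan (length xs) → ⊥
      longest⇒⊥ [ _ ] (s≤s ())
      -- Only `u₂` has to be avoided, hence it is passed twice.
      longest⇒⊥ {u} (_∷_ {w = u₂} uu₂ p) _ uniq longest with third-neighbour (3≤degree u) u₂ u₂
      ... | w , uw , w≢u₂ , _ with extend longest (uu₂ ∷ p) uniq refl uw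
      ...   | here refl = Adj⇒≢ uw refl
      ...   | there w∈ with split-before p w∈ w≢u₂
      ...     | ys , zs , _ , p₁ , d , p₂ , refl =
        no-lasso longest _ (uu₂ ∷ p₁) (s≤s (length-pos p₁)) p₂ d uw uniq refl refl

      -- This replaces the choice of a longest path: `d` bounds how often a path can still be
      -- lengthened, and at `zero` it would have more than `n` distinct vertices.
      no-path : ∀ d {u xs v} → Path u xs v → 2 ≤ length xs → Unique xs → n < d + length xs → ⊥
      no-path zero    p 2≤ uniq n<   = <⇒≱ n< (Unique⇒length≤ uniq)
      no-path (suc d) p 2≤ uniq n<   = longest⇒⊥ p 2≤ uniq λ q uniq′ longer →
        no-path d q (≤-trans 2≤ (<⇒≤ longer)) uniq′
          (≤-trans n< (≤-trans (≤-reflexive (sym (+-suc d _))) (+-monoʳ-≤ d longer)))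

      3≤degree⇒⊥ : Fin n → ⊥
      3≤degree⇒⊥ u with third-neighbour (3≤degree u) u u
      ... | w , uw , _ = no-path (suc n) (uw ∷ [ w ]) ≤-refl
              ((Adj⇒≢ uw All.∷ All.[]) ∷ All.[] ∷ []) (s≤s (m≤m+n n 2))

-- From even degrees to the theorem

Even∧≢2⇒3≤ : ∀ d → Even d → 1 ≤ d → d ≢ 2 → 3 ≤ d
Even∧≢2⇒3≤ 1                   ()
Even∧≢2⇒3≤ 2                   _ _ d≢2 = ⊥-elim (d≢2 refl)
Even∧≢2⇒3≤ (suc (suc (suc _))) _ _ _   = s≤s (s≤s (s≤s z≤n))

theorem18 : ∀ (n : ℕ) (G : Graph n) → InE12 G → ∃[ v ] (degree G v ≡ 2)
theorem18 n G ((connected , even) , type12 , (_ , C , _) , _) with any? (λ v → degree G v ≟ⁿ 2)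
... | yes found = found
... | no  none  = ⊥-elim (3≤degree⇒⊥ G type12
        -- The cycle `C` serves twice: it excludes degree 0, and it supplies a vertex from which to
        -- start a path.
        (λ u → Even∧≢2⇒3≤ _ (even u) (degree-positive G connected C u) (λ d≡2 → none (u , d≡2)))
        (vertex C))
  where
  vertex : ∀ {k} → Cycle G k → Fin n
  vertex record { three = s≤s _ ; vert = vert } = vert zero
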